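{- Every connected block graph $H$ is (isomorphic to) the reduced clique graph $C_r(G)$ of some $k$-tree $G$, for some integer $k\ge 1$.
   Context: A block graph is a graph in which every block (maximal 2-connected subgraph, or bridge) is a complete graph. A $k$-tree: $K_{k+1}$ is a $k$-tree, and adding to a $k$-tree a new vertex adjacent exactly to the vertices of a $k$-clique gives a $k$-tree. For a chordal graph $G$, maximal cliques $Q,Q'$ form a separating pair if $Q\cap Q'\ne\emptyset$ and every path in $G$ from $Q\setminus Q'$ to $Q'\setminus Q$ contains a vertex of $Q\cap Q'$; the reduced clique graph $C_r(G)$ has the maximal cliques of $G$ as vertices, two adjacent iff they form a separating pair. -}

module Defs where

open import Data.Nat using (ℕ; zero; suc; _≤_)
open import Data.Fin using (Fin; zero; suc; _≟_)
open import Data.Fin.Subset using (Subset; _∈_; _∉_; _⊆_; _∩_; _─_; _-_; ∣_∣; Nonempty; ⊤)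
open import Data.Bool using (Bool; true; false; not)
open import Data.Product using (Σ; ∃; _×_; _,_)
open import Relation.Nullary using (¬_; does)
open import Relation.Binary.PropositionalEquality using (_≡_; _≢_; refl)
open import Data.Vec using (lookup)

record Graph (n : ℕ) : Set where
  field
    adj   : Fin n → Fin n → Bool
    sym   : ∀ u v → adj u v ≡ adj v u
    irref : ∀ v → adj v v ≡ false
open Graph public

Adj : ∀ {n} → Graph n → Fin n → Fin n → Set
Adj G u v = adj G u v ≡ true

data Reach {n} (G : Graph n) (S : Subset n) (u : Fin n) : Fin n → Set where
  here : u ∈ S → Reach G S u u
  step : ∀ {w v} → Reach G S u w → Adj G w v → v ∈ S → Reach G S u v

InducedConnected : ∀ {n} → Graph n → Subset n → Set
InducedConnected G S = ∀ u v → u ∈ S → v ∈ S → Reach G S u v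

Connected : ∀ {n} → Graph n → Set
Connected {n} G = (1 ≤ n) × InducedConnected G ⊤

IsClique : ∀ {n} → Graph n → Subset n → Set
IsClique G Q = ∀ u v → u ∈ Q → v ∈ Q → u ≢ v → Adj G u v

IsMaximalClique : ∀ {n} → Graph n → Subset n → Set
IsMaximalClique G Q = IsClique G Q × (∀ Q' → IsClique G Q' → Q ⊆ Q' → Q' ≡ Q)

IsNonseparable : ∀ {n} → Graph n → Subset n → Set
IsNonseparable G B =
  (2 ≤ ∣ B ∣) × InducedConnected G B × (∀ v → v ∈ B → InducedConnected G (B - v))

IsBlock : ∀ {n} → Graph n → Subset n → Set
IsBlock G B = IsNonseparable G B × (∀ B' → IsNonseparable G B' → B ⊆ B' → B' ≡ B)

IsBlockGraph : ∀ {n} → Graph n → Set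
IsBlockGraph G = ∀ B → IsBlock G B → IsClique G B

private
  ≢-not : ∀ {n} (i j : Fin n) → Bool
  ≢-not i j = not (does (i ≟ j))

  complete-sym : ∀ {n} (u v : Fin n) → ≢-not u v ≡ ≢-not v u
  complete-sym u v with u ≟ v | v ≟ u
  ... | Relation.Nullary.yes _ | Relation.Nullary.yes _ = refl
  ... | Relation.Nullary.no _  | Relation.Nullary.no _  = refl
  ... | Relation.Nullary.yes refl | Relation.Nullary.no q with q refl
  ... | ()
  complete-sym u v | Relation.Nullary.no p | Relation.Nullary.yes refl with p refl
  ... | ()

  complete-irr : ∀ {n} (v : Fin n) → ≢-not v v ≡ false
  complete-irr v with v ≟ v
  ... | Relation.Nullary.yes _ = refl
  ... | Relation.Nullary.no p with p refl
  ... | ()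

Complete : (n : ℕ) → Graph n
Complete n = record { adj = ≢-not ; sym = complete-sym ; irref = complete-irr }

extAdj : ∀ {n} → Graph n → Subset n → Fin (suc n) → Fin (suc n) → Bool
extAdj G C zero    zero    = false
extAdj G C zero    (suc j) = lookup C j
extAdj G C (suc i) zero    = lookup C i
extAdj G C (suc i) (suc j) = adj G i j

extSym : ∀ {n} (G : Graph n) (C : Subset n) u v → extAdj G C u v ≡ extAdj G C v u
extSym G C zero    zero    = refl
extSym G C zero    (suc j) = refl
extSym G C (suc i) zero    = refl
extSym G C (suc i) (suc j) = sym G i j

extIrr : ∀ {n} (G : Graph n) (C : Subset n) v → extAdj G C v v ≡ false
extIrr G C zero    = refl
extIrr G C (suc i) = irref G i

extend : ∀ {n} → Graph n → Subset n → Graph (suc n)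
extend G C = record { adj = extAdj G C ; sym = extSym G C ; irref = extIrr G C }

data KTree (k : ℕ) : {n : ℕ} → Graph n → Set where
  base : KTree k (Complete (suc k))
  add  : ∀ {n} {G : Graph n} (C : Subset n) →
         KTree k G → IsClique G C → ∣ C ∣ ≡ k → KTree k (extend G C)

-- every path from Q ∖ Q' to Q' ∖ Q meets Q ∩ Q', i.e. no walk avoiding Q ∩ Q'
IsSeparatingPair : ∀ {n} → Graph n → Subset n → Subset n → Set
IsSeparatingPair G Q Q' =
  Nonempty (Q ∩ Q') ×
  (∀ u v → u ∈ (Q ─ Q') → v ∈ (Q' ─ Q) → ¬ Reach G (⊤ ─ (Q ∩ Q')) u v)

CrAdj : ∀ {n} → Graph n → Subset n → Subset n → Set
CrAdj G Q Q' = Q ≢ Q' × IsSeparatingPair G Q Q'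

IsoToReducedCliqueGraph : ∀ {m n} → Graph m → Graph n → Set
IsoToReducedCliqueGraph {m} {n} H G =
  Σ (Fin m → Subset n) λ f →
    (∀ i → IsMaximalClique G (f i)) ×
    (∀ i j → f i ≡ f j → i ≡ j) ×
    (∀ Q → IsMaximalClique G Q → ∃ λ i → f i ≡ Q) ×
    (∀ i j → (Adj H i j → CrAdj G (f i) (f j)) × (CrAdj G (f i) (f j) → Adj H i j))

{-# OPTIONS --safe #-}
-- In a k-tree two distinct maximal cliques form a separating pair exactly when
-- they share k vertices: fewer than k vertices never separate, and k common
-- vertices always do.  So it suffices to realise the adjacency of H by
-- (k+1)-cliques meeting in k vertices.  Grow a connected vertex set W of H one
-- vertex v at a time.  Two neighbours of v in W lie with v on a cycle, which is
-- nonseparable and hence a clique; so the neighbours of v in W form a clique,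
-- and a vertex of W adjacent to two of them is itself one of them.  If v has two
-- neighbours a, b in W, the new clique is attached along the intersection of the
-- cliques of a and b; if it has only one, it is attached along a k-subset of the
-- clique of a contained in no other clique, which exists by pigeonhole for k = m.
module Submission where

open import Defs
open import Data.Nat using (ℕ; zero; suc; _+_; _≤_; _<_; s≤s; _≤?_)
open import Data.Nat.Properties as ℕ using (≤-refl; ≤-reflexive; ≤-trans; ≤-antisym; ≤-pred; <-irrefl; ≤⇒≯; <⇒≱; ≰⇒>; ≮⇒≥; +-suc; +-monoʳ-≤; m≤m+n)
open import Data.Bool using (true; if_then_else_)
import Data.Bool.Properties as Bool
open import Data.Empty using (⊥-elim)
open import Data.Fin using (Fin; zero; suc; _≟_)
open import Data.Fin.Properties using (any?; suc-injective; injective⇒≤)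
open import Data.Fin.Subset using (Subset; inside; outside; _∈_; _∉_; _⊆_; _∩_; _∪_; _─_; _-_; ∣_∣; ⁅_⁆; ⊤; ⊥)
open import Data.Fin.Subset.Properties
open import Data.Vec using (_∷_; here; there)
open import Data.Vec.Properties using ([]=⇒lookup; lookup⇒[]=; ∷-injectiveʳ)
open import Data.Product using (Σ; ∃; _×_; _,_; proj₁; proj₂)
open import Data.Sum using (_⊎_; inj₁; inj₂)
open import Relation.Nullary using (¬_; Dec; yes; no; does; contradiction; ¬?)
open import Relation.Nullary.Decidable using (_×-dec_; decidable-stable)
open import Relation.Binary.PropositionalEquality using (_≡_; _≢_; refl; trans; cong; subst; ≢-sym) renaming (sym to ≡-sym)
open import Function using (_∘_)

private variable
  k m n : ℕ

-- Finite subsets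

x∈p─q⇒x∉q : ∀ (p q : Subset n) {x} → x ∈ p ─ q → x ∉ q
x∈p─q⇒x∉q (s ∷ p) (inside  ∷ q) (there x∈) (there x∈q) = x∈p─q⇒x∉q p q x∈ x∈q
x∈p─q⇒x∉q (s ∷ p) (outside ∷ q) (there x∈) (there x∈q) = x∈p─q⇒x∉q p q x∈ x∈q

module _ {n : ℕ} where

  x∈p-y⇒x≢y : ∀ (p : Subset n) y {x} → x ∈ p - y → x ≢ y
  x∈p-y⇒x≢y p y x∈ refl = x∈p─q⇒x∉q p ⁅ y ⁆ x∈ (x∈⁅x⁆ y)

  -mono : ∀ {p q : Subset n} {x} → p ⊆ q → p - x ⊆ q - x
  -mono {p} {q} {x} p⊆q z∈ = x∈p∧x≢y⇒x∈p-y (p⊆q (p─q⊆p p ⁅ x ⁆ z∈)) (x∈p-y⇒x≢y p x z∈)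

  x∈p∪⁅x⁆ : ∀ (p : Subset n) x → x ∈ p ∪ ⁅ x ⁆
  x∈p∪⁅x⁆ p x = q⊆p∪q p ⁅ x ⁆ (x∈⁅x⁆ x)

  x∈p∪⁅y⁆⁻ : ∀ (p : Subset n) y {x} → x ∈ p ∪ ⁅ y ⁆ → x ∈ p ⊎ x ≡ y
  x∈p∪⁅y⁆⁻ p y x∈ with x∈p∪q⁻ p ⁅ y ⁆ x∈
  ... | inj₁ x∈p = inj₁ x∈p
  ... | inj₂ x∈y = inj₂ (x∈⁅y⁆⇒x≡y y x∈y)

  x∉p⇒∣p∣<∣p∪⁅x⁆∣ : ∀ {p : Subset n} {x} → x ∉ p → ∣ p ∣ < ∣ p ∪ ⁅ x ⁆ ∣
  x∉p⇒∣p∣<∣p∪⁅x⁆∣ {p} {x} x∉p =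
    p⊂q⇒∣p∣<∣q∣ (p⊆p∪q ⁅ x ⁆ , x , x∈p∪⁅x⁆ p x , x∉p)

  p⊆q∧∣q∣≤∣p∣⇒q⊆p : ∀ {p q : Subset n} → p ⊆ q → ∣ q ∣ ≤ ∣ p ∣ → q ⊆ p
  p⊆q∧∣q∣≤∣p∣⇒q⊆p {p} p⊆q q≤p {x} x∈q = decidable-stable (x ∈? p)
    λ x∉p → ≤⇒≯ q≤p (p⊂q⇒∣p∣<∣q∣ (p⊆q , x , x∈q , x∉p))

  p⊆q∧∣q∣≤∣p∣⇒p≡q : ∀ {p q : Subset n} → p ⊆ q → ∣ q ∣ ≤ ∣ p ∣ → p ≡ q
  p⊆q∧∣q∣≤∣p∣⇒p≡q p⊆q q≤p = ⊆-antisym p⊆q (p⊆q∧∣q∣≤∣p∣⇒q⊆p p⊆q q≤p)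

  ∣p∣<∣q∣⇒∃∈q∉p : ∀ (p q : Subset n) → ∣ p ∣ < ∣ q ∣ → ∃ λ x → x ∈ q × x ∉ p
  ∣p∣<∣q∣⇒∃∈q∉p p q p<q with any? (λ x → (x ∈? q) ×-dec ¬? (x ∈? p))
  ... | yes found = found
  ... | no none = contradiction p<q (≤⇒≯ (p⊆q⇒∣p∣≤∣q∣
          λ {x} x∈q → decidable-stable (x ∈? p) λ x∉p → none (x , x∈q , x∉p)))

  p≢q⇒∃∈p∉q : ∀ (p q : Subset n) → ∣ p ∣ ≡ ∣ q ∣ → p ≢ q → ∃ λ x → x ∈ p × x ∉ q
  p≢q⇒∃∈p∉q p q p≡q p≢q with any? (λ x → (x ∈? p) ×-dec ¬? (x ∈? q))
  ... | yes found = found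
  ... | no none = contradiction (p⊆q∧∣q∣≤∣p∣⇒p≡q
          (λ {x} x∈p → decidable-stable (x ∈? q) λ x∉q → none (x , x∈p , x∉q))
          (≤-reflexive (≡-sym p≡q))) p≢q

  p≢q⇒∣p∩q∣≤k : ∀ {p q : Subset n} → ∣ p ∣ ≡ suc k → ∣ q ∣ ≡ suc k → p ≢ q → ∣ p ∩ q ∣ ≤ k
  p≢q⇒∣p∩q∣≤k {p = p} {q} p≡ q≡ p≢q with p≢q⇒∃∈p∉q p q (trans p≡ (≡-sym q≡)) p≢q
  ... | x , x∈p , x∉q = ≤-pred (≤-trans
    (p⊂q⇒∣p∣<∣q∣ (p∩q⊆p p q , x , x∈p , x∉q ∘ p∩q⊆q p q)) (≤-reflexive p≡))

  2+∣p∩q∣≤∣p∣ : ∀ {p q : Subset n} {x y} → x ≢ y →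
                x ∈ p → y ∈ p → x ∉ q → y ∉ q → 2 + ∣ p ∩ q ∣ ≤ ∣ p ∣
  2+∣p∩q∣≤∣p∣ {p} {q} {x} {y} x≢y x∈p y∈p x∉q y∉q = ≤-trans
    (s≤s (≤-trans (s≤s (p⊆q⇒∣p∣≤∣q∣ p∩q⊆p-x-y))
      (x∈p⇒∣p-x∣<∣p∣ (x∈p∧x≢y⇒x∈p-y y∈p (≢-sym x≢y)))))
    (x∈p⇒∣p-x∣<∣p∣ x∈p)
    where
    p∩q⊆p-x-y : p ∩ q ⊆ p - x - y
    p∩q⊆p-x-y z∈ with x∈p∩q⁻ p q z∈
    ... | z∈p , z∈q = x∈p∧x≢y⇒x∈p-y
      (x∈p∧x≢y⇒x∈p-y z∈p λ { refl → x∉q z∈q }) λ { refl → y∉q z∈q }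

  -- Two distinct elements outside `q`, added to the `k` in `p ∩ q`, would give `p` at least `k + 2`
  -- elements.
  p─q-unique : ∀ {p q : Subset n} {x y} → ∣ p ∣ ≡ suc k → k ≤ ∣ p ∩ q ∣ →
               x ∈ p → y ∈ p → x ∉ q → y ∉ q → x ≡ y
  p─q-unique {x = x} {y} p≡1+k k≤p∩q x∈p y∈p x∉q y∉q = decidable-stable (x ≟ y)
    λ x≢y → <-irrefl refl (≤-trans (s≤s (s≤s k≤p∩q))
      (≤-trans (2+∣p∩q∣≤∣p∣ x≢y x∈p y∈p x∉q y∉q) (≤-reflexive p≡1+k)))

x∈p⇒1+∣p-x∣≡∣p∣ : ∀ {p : Subset n} {x} → x ∈ p → suc ∣ p - x ∣ ≡ ∣ p ∣
x∈p⇒1+∣p-x∣≡∣p∣ {p = inside ∷ p} here = cong (suc ∘ ∣_∣) (p─⊥≡p p)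
x∈p⇒1+∣p-x∣≡∣p∣ {p = inside ∷ p} (there x∈p) = cong suc (x∈p⇒1+∣p-x∣≡∣p∣ x∈p)
x∈p⇒1+∣p-x∣≡∣p∣ {p = outside ∷ p} (there x∈p) = x∈p⇒1+∣p-x∣≡∣p∣ x∈p

enumerate : (p : Subset n) → Fin ∣ p ∣ → Fin n
enumerate (inside  ∷ p) zero    = zero
enumerate (inside  ∷ p) (suc i) = suc (enumerate p i)
enumerate (outside ∷ p) i       = suc (enumerate p i)

enumerate-∈ : (p : Subset n) (i : Fin ∣ p ∣) → enumerate p i ∈ p
enumerate-∈ (inside  ∷ p) zero    = here
enumerate-∈ (inside  ∷ p) (suc i) = there (enumerate-∈ p i)
enumerate-∈ (outside ∷ p) i       = there (enumerate-∈ p i)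

enumerate-injective : (p : Subset n) {i j : Fin ∣ p ∣} →
                      enumerate p i ≡ enumerate p j → i ≡ j
enumerate-injective (inside  ∷ p) {zero}  {zero}  eq = refl
enumerate-injective (inside  ∷ p) {suc i} {suc j} eq =
  cong suc (enumerate-injective p (suc-injective eq))
enumerate-injective (outside ∷ p) eq = enumerate-injective p (suc-injective eq)

-- `g` takes the membership proof because in `free-facet` the image of an element is extracted from
-- it; injectivity must then compare elements across arbitrary proofs.
injection⇒∣p∣≤m : (p : Subset n) (g : ∀ {x} → x ∈ p → Fin m) →
        (∀ {x y} (x∈p : x ∈ p) (y∈p : y ∈ p) → g x∈p ≡ g y∈p → x ≡ y) → ∣ p ∣ ≤ m
injection⇒∣p∣≤m p g g-inj = injective⇒≤ {f = λ i → g (enumerate-∈ p i)}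
  λ eq → enumerate-injective p (g-inj _ _ eq)

-- Walks and paths

module _ (G : Graph n) where

  adj-sym : ∀ {u v} → Adj G u v → Adj G v u
  adj-sym {u} {v} = trans (sym G v u)

  adj⇒≢ : ∀ {u v} → Adj G u v → u ≢ v
  adj⇒≢ {u} u~u refl with trans (≡-sym (irref G u)) u~u
  ... | ()

  reach-mono : ∀ {S T u v} → S ⊆ T → Reach G S u v → Reach G T u v
  reach-mono S⊆T (here u∈)       = here (S⊆T u∈)
  reach-mono S⊆T (step r w~v v∈) = step (reach-mono S⊆T r) w~v (S⊆T v∈)

  reach-trans : ∀ {S u v w} → Reach G S u v → Reach G S v w → Reach G S u w
  reach-trans r (here _)        = r
  reach-trans r (step s x~w w∈) = step (reach-trans r s) x~w w∈

  reach-end : ∀ {S u v} → Reach G S u v → v ∈ S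
  reach-end (here u∈)     = u∈
  reach-end (step _ _ v∈) = v∈

  reach-cons : ∀ {S u v w} → Adj G u v → u ∈ S → v ∈ S → Reach G S v w → Reach G S u w
  reach-cons u~v u∈ v∈ r = reach-trans (step (here u∈) u~v v∈) r

  reach-sym : ∀ {S u v} → Reach G S u v → Reach G S v u
  reach-sym (here u∈)       = here u∈
  reach-sym (step r w~v v∈) = reach-cons (adj-sym w~v) v∈ (reach-end r) (reach-sym r)

  hub⇒connected : ∀ {S} h → (∀ {y} → y ∈ S → Reach G S y h) → InducedConnected G S
  hub⇒connected h to-hub u v u∈ v∈ = reach-trans (to-hub u∈) (reach-sym (to-hub v∈))

  -- Going back along the walk from `v`, the first vertex met in `W` is followed by one outside.
  -- Such an edge supplies the next vertex by which a connected set of `H` grows.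
  reach-exits : ∀ {S W u v} → u ∈ W → v ∉ W → Reach G S u v →
                ∃ λ a → ∃ λ b → a ∈ W × b ∉ W × Adj G a b
  reach-exits u∈W v∉W (here _) = contradiction u∈W v∉W
  reach-exits {W = W} u∈W v∉W (step {w} {v} r w~v _) with w ∈? W
  ... | yes w∈W = w , v , w∈W , v∉W , w~v
  ... | no  w∉W = reach-exits u∈W w∉W r

  -- The condition `a ∉ S` makes the path simple. The last index is its exact vertex set, which
  -- becomes that of a cycle once an apex is added.
  data Path : Fin n → Fin n → Subset n → Set where
    stop : ∀ {a} → Path a a ⁅ a ⁆
    cons : ∀ {a b c S} → Adj G a b → a ∉ S → Path b c S → Path a c (S ∪ ⁅ a ⁆)

  path-start : ∀ {a b S} → Path a b S → a ∈ S
  path-start {a} stop = x∈⁅x⁆ a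
  path-start {a} (cons {S = S} _ _ _) = x∈p∪⁅x⁆ S a

  path-reach-end : ∀ {a b S y} → Path a b S → y ∈ S → Reach G S y b
  path-reach-end {a} stop y∈ with x∈⁅y⁆⇒x≡y a y∈
  ... | refl = here y∈
  path-reach-end {a} (cons {S = S} a~c a∉ p) y∈ with x∈p∪⁅y⁆⁻ S a y∈
  ... | inj₁ y∈S  = reach-mono (p⊆p∪q ⁅ a ⁆) (path-reach-end p y∈S)
  ... | inj₂ refl = reach-cons a~c y∈ (p⊆p∪q ⁅ a ⁆ (path-start p))
                      (reach-mono (p⊆p∪q ⁅ a ⁆) (path-reach-end p (path-start p)))

  path-suffix : ∀ {a b S x} → Path a b S → x ∈ S → ∃ λ T → T ⊆ S × Path x b T
  path-suffix {a} stop x∈ with x∈⁅y⁆⇒x≡y a x∈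
  ... | refl = _ , (λ z∈ → z∈) , stop
  path-suffix {a} (cons {S = S} a~c a∉ p) x∈ with x∈p∪⁅y⁆⁻ S a x∈
  ... | inj₂ refl = _ , (λ z∈ → z∈) , cons a~c a∉ p
  ... | inj₁ x∈S with path-suffix p x∈S
  ...   | T , T⊆S , q = T , p⊆p∪q ⁅ a ⁆ ∘ T⊆S , q

  -- Loop erasure: a vertex already on the path cuts it back to the suffix starting there. The path
  -- is reversed because a walk grows at its end and a `Path` at its start.
  reach⇒path : ∀ {U a b} → Reach G U a b → ∃ λ S → S ⊆ U × Path b a S
  reach⇒path {U} {a} (here a∈) =
    ⁅ a ⁆ , (λ z∈ → subst (_∈ U) (≡-sym (x∈⁅y⁆⇒x≡y a z∈)) a∈) , stop
  reach⇒path {U} (step {w} {v} r w~v v∈) with reach⇒path r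
  ... | S , S⊆U , p with v ∈? S
  ...   | no v∉S = S ∪ ⁅ v ⁆ , incl , cons (adj-sym w~v) v∉S p
    where
    incl : S ∪ ⁅ v ⁆ ⊆ U
    incl z∈ with x∈p∪⁅y⁆⁻ S v z∈
    ... | inj₁ z∈S  = S⊆U z∈S
    ... | inj₂ refl = v∈
  ...   | yes v∈S with path-suffix p v∈S
  ...     | T , T⊆S , q = T , S⊆U ∘ T⊆S , q

  -- Deleting x cuts a path in two, and each part keeps an end of the path.
  path-delete : ∀ {a b S x y} → Path a b S → x ∈ S → y ∈ S → y ≢ x →
                Reach G (S - x) y a ⊎ Reach G (S - x) y b
  path-delete {a} stop x∈ y∈ y≢x =
    contradiction (trans (x∈⁅y⁆⇒x≡y a y∈) (≡-sym (x∈⁅y⁆⇒x≡y a x∈))) y≢x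
  path-delete {a} {x = x} (cons {S = S} a~c a∉ p) x∈ y∈ y≢x
    with x∈p∪⁅y⁆⁻ S a x∈ | x∈p∪⁅y⁆⁻ S a y∈
  ... | inj₂ refl | inj₂ refl = contradiction refl y≢x
  ... | inj₂ refl | inj₁ y∈S = inj₂ (reach-mono
          (λ z∈ → x∈p∧x≢y⇒x∈p-y (p⊆p∪q ⁅ a ⁆ z∈) λ { refl → a∉ z∈ })
          (path-reach-end p y∈S))
  ... | inj₁ x∈S | inj₂ refl = inj₁ (here (x∈p∧x≢y⇒x∈p-y y∈ y≢x))
  ... | inj₁ x∈S | inj₁ y∈S with path-delete p x∈S y∈S y≢x
  ...   | inj₁ r = inj₁ (step (reach-mono (-mono (p⊆p∪q ⁅ a ⁆)) r) (adj-sym a~c)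
            (x∈p∧x≢y⇒x∈p-y (x∈p∪⁅x⁆ S a) λ { refl → a∉ x∈S }))
  ...   | inj₂ r = inj₂ (reach-mono (-mono (p⊆p∪q ⁅ a ⁆)) r)

  -- The apex closes the path into a cycle, or into an edge if the path is a single vertex. Deleting
  -- `v` leaves the path; deleting a path vertex leaves pieces that each keep an end, and both ends
  -- are adjacent to `v`.
  path+apex-nonseparable : ∀ {a b v S} → Path a b S → v ∉ S → Adj G v a → Adj G v b →
                           IsNonseparable G (S ∪ ⁅ v ⁆)
  path+apex-nonseparable {a} {b} {v} {S} p v∉S v~a v~b = size , hub⇒connected v to-v , delete
    where
    B = S ∪ ⁅ v ⁆
    S⊆B : S ⊆ B
    S⊆B = p⊆p∪q ⁅ v ⁆
    v∈B : v ∈ B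
    v∈B = x∈p∪⁅x⁆ S v
    size : 2 ≤ ∣ B ∣
    size = subst (_< ∣ B ∣) (∣⁅x⁆∣≡1 v) (p⊂q⇒∣p∣<∣q∣
      (q⊆p∪q S ⁅ v ⁆ , a , S⊆B (path-start p) , x≢y⇒x∉⁅y⁆ (≢-sym (adj⇒≢ v~a))))
    to-v : ∀ {y} → y ∈ B → Reach G B y v
    to-v y∈ with x∈p∪⁅y⁆⁻ S v y∈
    ... | inj₁ y∈S  = step (reach-mono S⊆B (path-reach-end p y∈S)) (adj-sym v~b) v∈B
    ... | inj₂ refl = here v∈B
    delete : ∀ x → x ∈ B → InducedConnected G (B - x)
    delete x x∈ with x∈p∪⁅y⁆⁻ S v x∈
    ... | inj₂ refl = hub⇒connected b to-b
      where
      to-b : ∀ {y} → y ∈ B - v → Reach G (B - v) y b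
      to-b y∈ with x∈p∪⁅y⁆⁻ S v (p─q⊆p B ⁅ v ⁆ y∈)
      ... | inj₂ y≡v = contradiction y≡v (x∈p-y⇒x≢y B v y∈)
      ... | inj₁ y∈S = reach-mono
        (λ z∈ → x∈p∧x≢y⇒x∈p-y (S⊆B z∈) λ { refl → v∉S z∈ }) (path-reach-end p y∈S)
    ... | inj₁ x∈S = hub⇒connected v to-v′
      where
      v∈B-x : v ∈ B - x
      v∈B-x = x∈p∧x≢y⇒x∈p-y v∈B λ { refl → v∉S x∈S }
      S-x⊆B-x : S - x ⊆ B - x
      S-x⊆B-x = -mono S⊆B
      to-v′ : ∀ {y} → y ∈ B - x → Reach G (B - x) y v
      to-v′ y∈ with x∈p∪⁅y⁆⁻ S v (p─q⊆p B ⁅ x ⁆ y∈)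
      ... | inj₂ refl = here v∈B-x
      ... | inj₁ y∈S with path-delete p x∈S y∈S (x∈p-y⇒x≢y B x y∈)
      ...   | inj₁ r = step (reach-mono S-x⊆B-x r) (adj-sym v~a) v∈B-x
      ...   | inj₂ r = step (reach-mono S-x⊆B-x r) (adj-sym v~b) v∈B-x

-- Block graphs

module _ (H : Graph m) (block : IsBlockGraph H) where

  -- `IsBlockGraph` speaks of maximal nonseparable sets only. If `u` and `v` in `B` were
  -- nonadjacent, no larger nonseparable set could be a clique, whereas by induction each of them is
  -- one; so `B` would itself be a block, hence a clique.
  nonseparable⇒clique : ∀ B → IsNonseparable H B → IsClique H B
  nonseparable⇒clique B = go m B (m≤m+n m ∣ B ∣)
    where
    -- `d` bounds the number of vertices outside `B` and drops whenever `B` is enlarged.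
    go : ∀ d B → m ≤ d + ∣ B ∣ → IsNonseparable H B → IsClique H B
    go d B m≤ nsB u v u∈ v∈ u≢v = decidable-stable (adj H u v Bool.≟ true) λ u≁v →
      u≁v (block B (nsB , maximal d m≤ u≁v) u v u∈ v∈ u≢v)
      where
      maximal : ∀ d → m ≤ d + ∣ B ∣ → ¬ Adj H u v →
                ∀ B′ → IsNonseparable H B′ → B ⊆ B′ → B′ ≡ B
      maximal zero m≤ u≁v B′ _ B⊆B′ =
        ≡-sym (p⊆q∧∣q∣≤∣p∣⇒p≡q B⊆B′ (≤-trans (∣p∣≤n B′) m≤))
      maximal (suc d) m≤ u≁v B′ nsB′ B⊆B′ with ∣ B′ ∣ ≤? ∣ B ∣
      ... | yes B′≤B = ≡-sym (p⊆q∧∣q∣≤∣p∣⇒p≡q B⊆B′ B′≤B)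
      ... | no  B′≰B = contradiction
              (go d B′ (≤-trans m≤ (d+ (≰⇒> B′≰B))) nsB′ u v (B⊆B′ u∈) (B⊆B′ v∈) u≢v) u≁v
        where
        d+ : ∣ B ∣ < ∣ B′ ∣ → suc d + ∣ B ∣ ≤ d + ∣ B′ ∣
        d+ B<B′ = subst (_≤ d + ∣ B′ ∣) (+-suc d ∣ B ∣) (+-monoʳ-≤ d B<B′)

  module _ {W : Subset m} (conn : InducedConnected H W) {v : Fin m} (v∉W : v ∉ W) where

    neighbours-clique : ∀ {a b} → a ∈ W → b ∈ W → Adj H v a → Adj H v b →
                        a ≢ b → Adj H a b
    neighbours-clique {a} {b} a∈ b∈ v~a v~b a≢b with reach⇒path H (conn b a b∈ a∈)
    ... | S , S⊆W , p = nonseparable⇒clique (S ∪ ⁅ v ⁆)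
      (path+apex-nonseparable H p (v∉W ∘ S⊆W) v~a v~b) a b
      (p⊆p∪q ⁅ v ⁆ (path-start H p))
      (p⊆p∪q ⁅ v ⁆ (reach-end H (path-reach-end H p (path-start H p)))) a≢b

    -- The path `a`, `x`, `b` is closed by `v` into a 4-cycle; being nonseparable, it must have the
    -- chord from `v` to `x`.
    diamond-free : ∀ {a b x} → a ∈ W → b ∈ W → x ∈ W → a ≢ b →
                   Adj H v a → Adj H v b → Adj H x a → Adj H x b → Adj H v x
    diamond-free {a} {b} {x} a∈ b∈ x∈ a≢b v~a v~b x~a x~b =
      nonseparable⇒clique (S ∪ ⁅ v ⁆) (path+apex-nonseparable H p v∉S v~a v~b) v x
        (x∈p∪⁅x⁆ S v) (p⊆p∪q ⁅ v ⁆ (p⊆p∪q ⁅ a ⁆ (x∈p∪⁅x⁆ ⁅ b ⁆ x)))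
        λ { refl → v∉W x∈ }
      where
      S = (⁅ b ⁆ ∪ ⁅ x ⁆) ∪ ⁅ a ⁆
      a∉ : a ∉ ⁅ b ⁆ ∪ ⁅ x ⁆
      a∉ a∈′ with x∈p∪⁅y⁆⁻ ⁅ b ⁆ x a∈′
      ... | inj₁ a∈b  = a≢b (x∈⁅y⁆⇒x≡y b a∈b)
      ... | inj₂ refl = adj⇒≢ H x~a refl
      p : Path H a b S
      p = cons (adj-sym H x~a) a∉ (cons x~b (x≢y⇒x∉⁅y⁆ (adj⇒≢ H x~b)) stop)
      v∉S : v ∉ S
      v∉S v∈S with x∈p∪⁅y⁆⁻ (⁅ b ⁆ ∪ ⁅ x ⁆) a v∈S
      ... | inj₂ refl = v∉W a∈
      ... | inj₁ v∈S′ with x∈p∪⁅y⁆⁻ ⁅ b ⁆ x v∈S′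
      ...   | inj₂ refl = v∉W x∈
      ...   | inj₁ v∈b  = v∉W (subst (_∈ W) (≡-sym (x∈⁅y⁆⇒x≡y b v∈b)) b∈)

-- Separation in k-trees

complete-adj : ∀ {u v : Fin n} → u ≢ v → Adj (Complete n) u v
complete-adj {u = u} {v} u≢v with u ≟ v
... | yes u≡v = contradiction u≡v u≢v
... | no  _   = refl

module _ (G : Graph n) (C : Subset n) where

  extend-reach : ∀ {U s x y} → Reach G U x y → Reach (extend G C) (s ∷ U) (suc x) (suc y)
  extend-reach (here x∈)       = here (there x∈)
  extend-reach (step r w~y y∈) = step (extend-reach r) w~y (there y∈)

  module _ (C-clique : IsClique G C) where

    -- A walk through the new vertex enters and leaves it via the clique C.
    shortcut-new : ∀ {U s x} → Reach (extend G C) (s ∷ U) (suc x) zero →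
                   ∃ λ c → c ∈ C × Reach G U x c
    shortcut : ∀ {U s x y} → Reach (extend G C) (s ∷ U) (suc x) (suc y) → Reach G U x y

    shortcut-new (step {suc w} r w∈C _) = w , lookup⇒[]= w C w∈C , shortcut r

    shortcut (here (there x∈)) = here x∈
    shortcut (step {suc w} r w~y (there y∈)) = step (shortcut r) w~y y∈
    shortcut {y = y} (step {zero} r y∈C (there y∈)) with shortcut-new r
    ... | c , c∈C , r′ with c ≟ y
    ...   | yes refl = r′
    ...   | no  c≢y  = step r′ (C-clique c y c∈C (lookup⇒[]= y C y∈C) c≢y) y∈

  -- All neighbours of the new vertex lie in `C`, so a walk confined to `s ∷ U` cannot leave it.
  new-isolated : ∀ {U s y} → (∀ {c} → c ∈ C → c ∉ U) →
                 ¬ Reach (extend G C) (s ∷ U) zero (suc y)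
  new-isolated C∩U=∅ (step {zero}  _ y∈C (there y∈)) = C∩U=∅ (lookup⇒[]= _ C y∈C) y∈
  new-isolated C∩U=∅ (step {suc w} r _ _) = new-isolated C∩U=∅ r

  adj-new⇒∈ : ∀ {i} → Adj (extend G C) zero (suc i) → i ∈ C
  adj-new⇒∈ {i} = lookup⇒[]= i C

-- Induction on the construction. If the new vertex is `x` or `y`, its neighbourhood `C` equals `T`,
-- and avoiding `T` isolates it. If it lies in `T`, there is no room in `C` for both `x` and `y`.
-- Otherwise the walk can be rerouted through the smaller tree. `U` is any set disjoint from `T`, a
-- property that passes to tails.
ktree-separated : {G : Graph n} → KTree k G → ∀ {T U x y} →
  IsClique G T → ∣ T ∣ ≡ k → (∀ {u} → u ∈ U → u ∉ T) → x ≢ y → x ∉ T → y ∉ T →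
  (∀ {t} → t ∈ T → Adj G x t) → (∀ {t} → t ∈ T → Adj G y t) → ¬ Reach G U x y
-- Only one of the `k + 1` vertices lies outside `T`.
ktree-separated {k = k} base {T} _ T≡k _ x≢y x∉ y∉ _ _ _ = x≢y (p─q-unique (∣⊤∣≡n (suc k))
  (≤-trans (≤-reflexive (≡-sym T≡k)) (p⊆q⇒∣p∣≤∣q∣ {p = T} {⊤ ∩ T} λ t∈ → x∈p∩q⁺ (∈⊤ , t∈))) ∈⊤ ∈⊤ x∉ y∉)
ktree-separated (add {G = G} C _ _ C≡k) {outside ∷ T} {s ∷ U} {zero} {zero}
  _ _ _ x≢y _ _ _ _ _ = x≢y refl
ktree-separated (add {G = G} C _ _ C≡k) {outside ∷ T} {s ∷ U} {zero} {suc y}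
  _ T≡k disj x≢y _ _ x~T _ = new-isolated G C λ c∈C c∈U → disj (there c∈U) (there (C⊆T c∈C))
  where
  C⊆T : C ⊆ T
  C⊆T = p⊆q∧∣q∣≤∣p∣⇒q⊆p (λ t∈ → adj-new⇒∈ G C (x~T (there t∈)))
          (≤-reflexive (trans C≡k (≡-sym T≡k)))
ktree-separated kt@(add {G = G} C _ _ _) {outside ∷ T} {s ∷ U} {suc x} {zero}
  T-cl T≡k disj x≢y x∉ y∉ x~T y~T r =
  ktree-separated kt T-cl T≡k disj (≢-sym x≢y) y∉ x∉ y~T x~T (reach-sym (extend G C) r)
ktree-separated (add {G = G} C kt C-cl C≡k) {outside ∷ T} {s ∷ U} {suc x} {suc y}
  T-cl T≡k disj x≢y x∉ y∉ x~T y~T r =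
  ktree-separated kt {T} {U}
    (λ u v u∈ v∈ u≢v → T-cl (suc u) (suc v) (there u∈) (there v∈) (u≢v ∘ suc-injective))
    T≡k (λ u∈ u∈T → disj (there u∈) (there u∈T)) (x≢y ∘ cong suc)
    (x∉ ∘ there) (y∉ ∘ there) (x~T ∘ there) (y~T ∘ there) (shortcut G C C-cl r)
ktree-separated (add C _ _ C≡k) {inside ∷ T} {x = zero} _ _ _ _ x∉ _ _ _ _ = x∉ here
ktree-separated (add C _ _ C≡k) {inside ∷ T} {y = zero} _ _ _ _ _ y∉ _ _ _ = y∉ here
-- The new vertex is adjacent only to `C`, so `x`, `y` and the other `k - 1` vertices of the
-- separator all lie in `C`, which has just `k` elements.
ktree-separated (add {G = G} C _ _ C≡k) {inside ∷ T} {x = suc x} {suc y}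
  T-cl T≡k _ x≢y x∉ y∉ x~T y~T _ = x≢y (cong suc (p─q-unique
    (trans C≡k (≡-sym T≡k)) (p⊆q⇒∣p∣≤∣q∣ T⊆C∩T)
    (adj-new⇒∈ G C (x~T here)) (adj-new⇒∈ G C (y~T here)) (x∉ ∘ there) (y∉ ∘ there)))
  where
  T⊆C∩T : T ⊆ C ∩ T
  T⊆C∩T t∈ = x∈p∩q⁺ (adj-new⇒∈ G C (T-cl zero _ here (there t∈) λ ()) , t∈)

-- The new vertex has `k` neighbours, so one of them survives the removal of fewer than `k` vertices
-- and links it to the smaller tree, which stays connected by induction.
ktree-connected : {G : Graph n} → KTree k G → ∀ {T U x y} →
  ∣ T ∣ < k → (∀ {u} → u ∉ T → u ∈ U) → x ∉ T → y ∉ T → Reach G U x y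
ktree-connected base {x = x} {y} _ T∪U x∉ y∉ with x ≟ y
... | yes refl = here (T∪U x∉)
... | no  x≢y  = step (here (T∪U x∉)) (complete-adj x≢y) (T∪U y∉)
ktree-connected (add {G = G} C kt C-cl C≡k) {t ∷ T} {s ∷ U} {x} {y} T<k T∪U = go x y
  where
  T<k′ : ∣ T ∣ < _
  T<k′ = ≤-trans (s≤s (∣p∣≤∣x∷p∣ t T)) T<k
  T∪U′ : ∀ {u} → u ∉ T → u ∈ U
  T∪U′ u∉ = drop-there (T∪U (u∉ ∘ drop-there))
  old : ∀ {x y} → x ∉ T → y ∉ T → Reach (extend G C) (s ∷ U) (suc x) (suc y)
  old x∉ y∉ = extend-reach G C (ktree-connected kt T<k′ T∪U′ x∉ y∉)
  new : ∀ {y} → zero ∉ t ∷ T → y ∉ T → Reach (extend G C) (s ∷ U) zero (suc y)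
  new 0∉ y∉ with ∣p∣<∣q∣⇒∃∈q∉p T C (≤-trans T<k′ (≤-reflexive (≡-sym C≡k)))
  ... | c , c∈C , c∉T = reach-cons (extend G C) {v = suc c} ([]=⇒lookup c∈C)
          (T∪U 0∉) (T∪U (c∉T ∘ drop-there)) (old c∉T y∉)
  go : ∀ x y → x ∉ t ∷ T → y ∉ t ∷ T → Reach (extend G C) (s ∷ U) x y
  go zero    zero    x∉ y∉ = here (T∪U x∉)
  go zero    (suc y) x∉ y∉ = new x∉ (y∉ ∘ there)
  go (suc x) zero    x∉ y∉ = reach-sym (extend G C) (new y∉ (x∉ ∘ there))
  go (suc x) (suc y) x∉ y∉ = old (x∉ ∘ there) (y∉ ∘ there)

module _ {G : Graph n} (kt : KTree k G) {Q Q′ : Subset n}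
         (Q≡ : ∣ Q ∣ ≡ suc k) (Q′≡ : ∣ Q′ ∣ ≡ suc k) (Q≢Q′ : Q ≢ Q′) where

  private
    T = Q ∩ Q′
    Q─Q′ = p≢q⇒∃∈p∉q Q Q′ (trans Q≡ (≡-sym Q′≡)) Q≢Q′
    Q′─Q = p≢q⇒∃∈p∉q Q′ Q (trans Q′≡ (≡-sym Q≡)) (≢-sym Q≢Q′)

  -- Distinct sets of `k + 1` elements share at most `k`, so `T` is a `k`-clique joined completely
  -- to the vertices of both differences, as `ktree-separated` requires. The bound `1 ≤ k` makes it
  -- nonempty.
  k≤∣Q∩Q′∣⇒CrAdj : 1 ≤ k → IsClique G Q → IsClique G Q′ → k ≤ ∣ T ∣ → CrAdj G Q Q′
  k≤∣Q∩Q′∣⇒CrAdj 1≤k Q-cl Q′-cl k≤T = Q≢Q′ , nonempty , separated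
    where
    nonempty : ∃ λ x → x ∈ T
    nonempty = proj₁ witness , proj₁ (proj₂ witness)
      where
      witness = ∣p∣<∣q∣⇒∃∈q∉p ⊥ T
        (subst (_< ∣ T ∣) (≡-sym (∣⊥∣≡0 n)) (≤-trans 1≤k k≤T))
    separated : ∀ u v → u ∈ Q ─ Q′ → v ∈ Q′ ─ Q → ¬ Reach G (⊤ ─ T) u v
    separated u v u∈ v∈ = ktree-separated kt
      (λ x y x∈ y∈ → Q-cl x y (p∩q⊆p Q Q′ x∈) (p∩q⊆p Q Q′ y∈))
      (≤-antisym (p≢q⇒∣p∩q∣≤k Q≡ Q′≡ Q≢Q′) k≤T) (x∈p─q⇒x∉q ⊤ T)
      (λ { refl → v∉Q u∈Q }) u∉T v∉T
      (λ {t} t∈ → Q-cl u t u∈Q (p∩q⊆p Q Q′ t∈) λ { refl → u∉T t∈ })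
      (λ {t} t∈ → Q′-cl v t v∈Q′ (p∩q⊆q Q Q′ t∈) λ { refl → v∉T t∈ })
      where
      u∈Q  = p─q⊆p Q Q′ u∈
      v∈Q′ = p─q⊆p Q′ Q v∈
      v∉Q  = x∈p─q⇒x∉q Q′ Q v∈
      u∉T : u ∉ T
      u∉T = x∈p─q⇒x∉q Q Q′ u∈ ∘ p∩q⊆q Q Q′
      v∉T : v ∉ T
      v∉T = v∉Q ∘ p∩q⊆p Q Q′

  -- A smaller intersection leaves the `k`-tree connected when removed, so a walk avoiding it would
  -- join the two differences, which are nonempty because the cliques have equal size.
  CrAdj⇒k≤∣Q∩Q′∣ : CrAdj G Q Q′ → k ≤ ∣ T ∣
  CrAdj⇒k≤∣Q∩Q′∣ (_ , _ , separated) with Q─Q′ | Q′─Q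
  ... | u , u∈Q , u∉Q′ | v , v∈Q′ , v∉Q = ≮⇒≥ λ T<k → separated u v
    (x∈p∧x∉q⇒x∈p─q u∈Q u∉Q′) (x∈p∧x∉q⇒x∈p─q v∈Q′ v∉Q)
    (ktree-connected kt T<k (x∈p∧x∉q⇒x∈p─q ∈⊤) (u∉Q′ ∘ p∩q⊆q Q Q′) (v∉Q ∘ p∩q⊆p Q Q′))

-- Otherwise r contains both vertices outside p ∩ q, so that p ∪ q is a clique
-- on k + 2 vertices.
cliques-share : (G : Graph n) → (∀ Q → IsClique G Q → ∣ Q ∣ ≤ suc k) →
  ∀ {p q r} → IsClique G p → IsClique G q → IsClique G r →
  ∣ p ∣ ≡ suc k → ∣ q ∣ ≡ suc k → p ≢ q →
  k ≤ ∣ p ∩ q ∣ → k ≤ ∣ p ∩ r ∣ → k ≤ ∣ q ∩ r ∣ → p ∩ q ⊆ r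
cliques-share {k = k} G ω≤ {p} {q} {r} p-cl q-cl r-cl p≡ q≡ p≢q k≤pq k≤pr k≤qr {s} s∈
  with p≢q⇒∃∈p∉q p q (trans p≡ (≡-sym q≡)) p≢q
     | p≢q⇒∃∈p∉q q p (trans q≡ (≡-sym p≡)) (≢-sym p≢q)
... | x , x∈p , x∉q | y , y∈q , y∉p = decidable-stable (s ∈? r) impossible
  where
  s∈p = p∩q⊆p p q s∈
  s∈q = p∩q⊆q p q s∈
  impossible : ¬ (s ∉ r)
  impossible s∉r = <⇒≱ (≤-trans (≤-reflexive (cong suc (≡-sym p≡))) (x∉p⇒∣p∣<∣p∪⁅x⁆∣ y∉p))
                       (ω≤ (p ∪ ⁅ y ⁆) p∪y-cl)
    where
    -- At most one vertex of `p` is outside `r`; `s` is one already, and it differs from `x` because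
    -- it lies in `q`.
    x∈r : x ∈ r
    x∈r = decidable-stable (x ∈? r) λ x∉r →
      x∉q (subst (_∈ q) (p─q-unique p≡ k≤pr s∈p x∈p s∉r x∉r) s∈q)
    y∈r : y ∈ r
    y∈r = decidable-stable (y ∈? r) λ y∉r →
      y∉p (subst (_∈ p) (p─q-unique q≡ k≤qr s∈q y∈q s∉r y∉r) s∈p)
    to-y : ∀ u → u ∈ p → Adj G u y
    to-y u u∈p with u ∈? q
    ... | yes u∈q = q-cl u y u∈q y∈q λ { refl → y∉p u∈p }
    -- A vertex of `p` outside `q` can only be `x`, and `r` contains both `x` and `y`.
    ... | no  u∉q with p─q-unique p≡ k≤pq u∈p x∈p u∉q x∉q
    ...   | refl = r-cl x y x∈r y∈r λ { refl → y∉p x∈p }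
    p∪y-cl : IsClique G (p ∪ ⁅ y ⁆)
    p∪y-cl u v u∈ v∈ u≢v with x∈p∪⁅y⁆⁻ p y u∈ | x∈p∪⁅y⁆⁻ p y v∈
    ... | inj₁ u∈p  | inj₁ v∈p  = p-cl u v u∈p v∈p u≢v
    ... | inj₁ u∈p  | inj₂ refl = to-y u u∈p
    ... | inj₂ refl | inj₁ v∈p  = adj-sym G (to-y v v∈p)
    ... | inj₂ refl | inj₂ refl = contradiction refl u≢v

-- Growing the k-tree

-- The invariant of the growth, with separation replaced by a count of shared vertices. `f` is total
-- so that its domain stays fixed as `W` grows; it is constrained on `W` only. `f-covers` bounds the
-- size of cliques and ensures that no maximal clique is missed.
record Realisation (H : Graph m) (k : ℕ) (W : Subset m) : Set where
  field
    {order}     : ℕ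
    graph       : Graph order
    ktree       : KTree k graph
    f           : Fin m → Subset order
    f-clique    : ∀ {i} → i ∈ W → IsClique graph (f i)
    f-size      : ∀ {i} → i ∈ W → ∣ f i ∣ ≡ suc k
    f-covers    : ∀ Q → IsClique graph Q → ∃ λ i → i ∈ W × Q ⊆ f i
    f-injective : ∀ {i j} → i ∈ W → j ∈ W → f i ≡ f j → i ≡ j
    adj⇒share   : ∀ {i j} → i ∈ W → j ∈ W → i ≢ j → Adj H i j → k ≤ ∣ f i ∩ f j ∣
    share⇒adj   : ∀ {i j} → i ∈ W → j ∈ W → i ≢ j → k ≤ ∣ f i ∩ f j ∣ → Adj H i j

  clique-size : ∀ Q → IsClique graph Q → ∣ Q ∣ ≤ suc k
  clique-size Q Q-cl with f-covers Q Q-cl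
  ... | i , i∈W , Q⊆fi = ≤-trans (p⊆q⇒∣p∣≤∣q∣ Q⊆fi) (≤-reflexive (f-size i∈W))

  f-⊆-injective : ∀ {i j} → i ∈ W → j ∈ W → f i ⊆ f j → i ≡ j
  f-⊆-injective i∈W j∈W fi⊆fj = f-injective i∈W j∈W
    (p⊆q∧∣q∣≤∣p∣⇒p≡q fi⊆fj (≤-reflexive (trans (f-size j∈W) (≡-sym (f-size i∈W)))))

singleton-realisation : (H : Graph m) (k : ℕ) (r : Fin m) → Realisation H k ⁅ r ⁆
singleton-realisation H k r = record
  { graph       = Complete (suc k)
  ; ktree       = base
  ; f           = λ _ → ⊤
  ; f-clique    = λ _ u v _ _ → complete-adj
  ; f-size      = λ _ → ∣⊤∣≡n (suc k)
  ; f-covers    = λ _ _ → r , x∈⁅x⁆ r , ⊆⊤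
  ; f-injective = λ i∈ j∈ _ → same i∈ j∈
  ; adj⇒share   = λ i∈ j∈ i≢j → contradiction (same i∈ j∈) i≢j
  ; share⇒adj   = λ i∈ j∈ i≢j → contradiction (same i∈ j∈) i≢j
  }
  where
  same : ∀ {i j} → i ∈ ⁅ r ⁆ → j ∈ ⁅ r ⁆ → i ≡ j
  same i∈ j∈ = trans (x∈⁅y⁆⇒x≡y r i∈) (≡-sym (x∈⁅y⁆⇒x≡y r j∈))

module _ {H : Graph m} {W : Subset m} (R : Realisation H k W) where
  open Realisation R

  -- The clique formed by `S` and a new vertex meets an old `f i` in `S ∩ f i`, which has `k`
  -- elements exactly when `S ⊆ f i`. Lying inside some `f a` makes `S` a clique.
  AttachmentSet : Fin m → Subset order → Set
  AttachmentSet v S = ∣ S ∣ ≡ k × (∃ λ a → a ∈ W × S ⊆ f a) ×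
    (∀ {i} → i ∈ W → (Adj H v i → S ⊆ f i) × (S ⊆ f i → Adj H v i))

  attach : ∀ {v S} → v ∉ W → AttachmentSet v S → Realisation H k (W ∪ ⁅ v ⁆)
  attach {v} {S} v∉W (S≡k , (a , a∈W , S⊆fa) , iff) = record
    { graph       = extend graph S
    ; ktree       = add S ktree S-clique S≡k
    ; f           = f′
    ; f-clique    = clique′
    ; f-size      = size′
    ; f-covers    = covers′
    ; f-injective = injective′
    ; adj⇒share   = adj⇒share′
    ; share⇒adj   = share⇒adj′
    }
    where
    f′ : Fin m → Subset (suc order)
    f′ i = if does (i ≟ v) then inside ∷ S else outside ∷ f i

    f′-v : f′ v ≡ inside ∷ S
    f′-v with v ≟ v
    ... | yes _  = refl
    ... | no v≢v = contradiction refl v≢v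

    f′-W : ∀ {i} → i ∈ W → f′ i ≡ outside ∷ f i
    f′-W {i} i∈W with i ≟ v
    ... | yes refl = contradiction i∈W v∉W
    ... | no  _    = refl

    old : ∀ {i} → i ∈ W ∪ ⁅ v ⁆ → i ≢ v → i ∈ W
    old i∈ i≢v with x∈p∪⁅y⁆⁻ W v i∈
    ... | inj₁ i∈W = i∈W
    ... | inj₂ i≡v = contradiction i≡v i≢v

    S-clique : IsClique graph S
    S-clique x y x∈ y∈ = f-clique a∈W x y (S⊆fa x∈) (S⊆fa y∈)

    share⇒⊆ : ∀ {i} → k ≤ ∣ S ∩ f i ∣ → S ⊆ f i
    share⇒⊆ {i} k≤ = p∩q⊆q S (f i) ∘
      p⊆q∧∣q∣≤∣p∣⇒q⊆p (p∩q⊆p S (f i)) (≤-trans (≤-reflexive S≡k) k≤)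

    ⊆⇒share : ∀ {i} → S ⊆ f i → k ≤ ∣ S ∩ f i ∣
    ⊆⇒share S⊆fi = ≤-trans (≤-reflexive (≡-sym S≡k))
      (p⊆q⇒∣p∣≤∣q∣ λ x∈ → x∈p∩q⁺ (x∈ , S⊆fi x∈))

    clique′ : ∀ {i} → i ∈ W ∪ ⁅ v ⁆ → IsClique (extend graph S) (f′ i)
    clique′ {i} i∈ with i ≟ v
    ... | yes _ = λ
      { zero    zero    _          _          x≢y → contradiction refl x≢y
      ; zero    (suc y) _          (there y∈) _   → []=⇒lookup y∈
      ; (suc x) zero    (there x∈) _          _   → []=⇒lookup x∈
      ; (suc x) (suc y) (there x∈) (there y∈) x≢y → S-clique x y x∈ y∈ (x≢y ∘ cong suc) }
    ... | no i≢v = λ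
      { (suc x) (suc y) (there x∈) (there y∈) x≢y →
          f-clique (old i∈ i≢v) x y x∈ y∈ (x≢y ∘ cong suc) }

    size′ : ∀ {i} → i ∈ W ∪ ⁅ v ⁆ → ∣ f′ i ∣ ≡ suc k
    size′ {i} i∈ with i ≟ v
    ... | yes _   = cong suc S≡k
    ... | no  i≢v = f-size (old i∈ i≢v)

    covers′ : ∀ Q → IsClique (extend graph S) Q → ∃ λ i → i ∈ W ∪ ⁅ v ⁆ × Q ⊆ f′ i
    -- A clique through the new vertex has all its other vertices in `S`.
    covers′ (inside ∷ Q) Q-cl = v , x∈p∪⁅x⁆ W v , subst (inside ∷ Q ⊆_) (≡-sym f′-v)
      (in⊆in λ x∈ → adj-new⇒∈ graph S (Q-cl zero _ here (there x∈) λ ()))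
    covers′ (outside ∷ Q) Q-cl with f-covers Q
      (λ x y x∈ y∈ x≢y → Q-cl (suc x) (suc y) (there x∈) (there y∈) (x≢y ∘ suc-injective))
    ... | i , i∈W , Q⊆fi = i , p⊆p∪q ⁅ v ⁆ i∈W ,
      subst (outside ∷ Q ⊆_) (≡-sym (f′-W i∈W)) (out⊆ Q⊆fi)

    injective′ : ∀ {i j} → i ∈ W ∪ ⁅ v ⁆ → j ∈ W ∪ ⁅ v ⁆ → f′ i ≡ f′ j → i ≡ j
    injective′ {i} {j} i∈ j∈ eq with i ≟ v | j ≟ v
    ... | yes refl | yes refl = refl
    ... | yes _    | no  _    = contradiction eq λ ()
    ... | no  _    | yes _    = contradiction eq λ ()
    ... | no  i≢v  | no  j≢v  = f-injective (old i∈ i≢v) (old j∈ j≢v) (∷-injectiveʳ eq)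

    adj⇒share′ : ∀ {i j} → i ∈ W ∪ ⁅ v ⁆ → j ∈ W ∪ ⁅ v ⁆ → i ≢ j →
                 Adj H i j → k ≤ ∣ f′ i ∩ f′ j ∣
    adj⇒share′ {i} {j} i∈ j∈ i≢j i~j with i ≟ v | j ≟ v
    ... | yes refl | yes refl = contradiction refl i≢j
    ... | yes refl | no  j≢v  = ⊆⇒share (proj₁ (iff (old j∈ j≢v)) i~j)
    ... | no  i≢v  | yes refl = subst (λ p → k ≤ ∣ p ∣) (∩-comm S (f i))
                                  (⊆⇒share (proj₁ (iff (old i∈ i≢v)) (adj-sym H i~j)))
    ... | no  i≢v  | no  j≢v  = adj⇒share (old i∈ i≢v) (old j∈ j≢v) i≢j i~j

    share⇒adj′ : ∀ {i j} → i ∈ W ∪ ⁅ v ⁆ → j ∈ W ∪ ⁅ v ⁆ → i ≢ j →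
                 k ≤ ∣ f′ i ∩ f′ j ∣ → Adj H i j
    share⇒adj′ {i} {j} i∈ j∈ i≢j k≤ with i ≟ v | j ≟ v
    ... | yes refl | yes refl = contradiction refl i≢j
    ... | yes refl | no  j≢v  = proj₂ (iff (old j∈ j≢v)) (share⇒⊆ k≤)
    ... | no  i≢v  | yes refl = adj-sym H (proj₂ (iff (old i∈ i≢v))
                                  (share⇒⊆ (subst (λ p → k ≤ ∣ p ∣) (∩-comm (f i) S) k≤)))
    ... | no  i≢v  | no  j≢v  = share⇒adj (old i∈ i≢v) (old j∈ j≢v) i≢j k≤

  blocked? : ∀ a s → Dec (∃ λ i → i ∈ W × i ≢ a × f a - s ⊆ f i)
  blocked? a s = any? λ i → (i ∈? W) ×-dec (¬? (i ≟ a) ×-dec ((f a - s) ⊆? f i))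

  -- f a - s ⊆ f i and f a - t ⊆ f i with s ≢ t would give f a ⊆ f i, so each i
  -- rules out at most one s.
  free-facet : m ≤ k → ∀ {a} → a ∈ W →
    ∃ λ s → s ∈ f a × (∀ {i} → i ∈ W → i ≢ a → ¬ (f a - s ⊆ f i))
  free-facet m≤k {a} a∈W with any? (λ s → (s ∈? f a) ×-dec ¬? (blocked? a s))
  ... | yes (s , s∈ , free) = s , s∈ , λ i∈W i≢a facet⊆ → free (_ , i∈W , i≢a , facet⊆)
  -- If every facet of `f a` were blocked, choosing blockers would inject its `k + 1` vertices into
  -- `Fin m`.
  ... | no none = contradiction (≤-trans (≤-reflexive (≡-sym (f-size a∈W))) f≤m) (≤⇒≯ m≤k)
    where
    blocker : ∀ {s} → s ∈ f a → ∃ λ i → i ∈ W × i ≢ a × f a - s ⊆ f i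
    blocker {s} s∈ = decidable-stable (blocked? a s) λ free → none (s , s∈ , free)
    f≤m : ∣ f a ∣ ≤ m
    f≤m = injection⇒∣p∣≤m (f a) (λ s∈ → proj₁ (blocker s∈)) inj
      where
      inj : ∀ {s t} (s∈ : s ∈ f a) (t∈ : t ∈ f a) →
            proj₁ (blocker s∈) ≡ proj₁ (blocker t∈) → s ≡ t
      inj {s} {t} s∈ t∈ eq with blocker s∈ | blocker t∈
      inj {s} {t} s∈ t∈ refl | i , i∈W , i≢a , s⊆ | .i , _ , _ , t⊆ =
        decidable-stable (s ≟ t) λ s≢t → i≢a (≡-sym (f-⊆-injective a∈W i∈W (fa⊆fi s≢t)))
        where
        fa⊆fi : s ≢ t → f a ⊆ f i
        fa⊆fi s≢t {x} x∈ with x ≟ s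
        ... | yes refl = t⊆ (x∈p∧x≢y⇒x∈p-y x∈ s≢t)
        ... | no  x≢s  = s⊆ (x∈p∧x≢y⇒x∈p-y x∈ x≢s)

  attachmentSet : IsBlockGraph H → InducedConnected H W → m ≤ k →
    ∀ {v a} → v ∉ W → a ∈ W → Adj H v a → ∃ (AttachmentSet v)
  attachmentSet block conn m≤k {v} {a} v∉W a∈W v~a
    with any? (λ b → (b ∈? W) ×-dec (¬? (b ≟ a) ×-dec (adj H v b Bool.≟ true)))
  ... | yes (b , b∈W , b≢a , v~b) =
    f a ∩ f b , ≤-antisym fa∩fb≤k (adj⇒share a∈W b∈W a≢b a~b) ,
    (a , a∈W , p∩q⊆p (f a) (f b)) , λ i∈W → forth i∈W , back i∈W
    where
    a≢b = ≢-sym b≢a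
    a~b : Adj H a b
    a~b = neighbours-clique H block conn v∉W a∈W b∈W v~a v~b a≢b
    fa≢fb : f a ≢ f b
    fa≢fb = a≢b ∘ f-injective a∈W b∈W
    fa∩fb≤k = p≢q⇒∣p∩q∣≤k (f-size a∈W) (f-size b∈W) fa≢fb
    shares : ∀ {i c} → i ∈ W → c ∈ W → i ≢ c → Adj H v i → Adj H v c → k ≤ ∣ f c ∩ f i ∣
    shares i∈W c∈W i≢c v~i v~c = adj⇒share c∈W i∈W (≢-sym i≢c)
      (neighbours-clique H block conn v∉W c∈W i∈W v~c v~i (≢-sym i≢c))
    forth : ∀ {i} → i ∈ W → Adj H v i → f a ∩ f b ⊆ f i
    forth {i} i∈W v~i with i ≟ a | i ≟ b
    ... | yes refl | _ = p∩q⊆p (f a) (f b)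
    ... | _ | yes refl = p∩q⊆q (f a) (f b)
    -- The neighbours `a`, `b`, `i` of `v` are pairwise adjacent, so their cliques pairwise share
    -- `k` vertices.
    ... | no i≢a | no i≢b = cliques-share graph clique-size
      (f-clique a∈W) (f-clique b∈W) (f-clique i∈W) (f-size a∈W) (f-size b∈W) fa≢fb
      (adj⇒share a∈W b∈W a≢b a~b)
      (shares i∈W a∈W i≢a v~i v~a) (shares i∈W b∈W i≢b v~i v~b)
    back : ∀ {i} → i ∈ W → f a ∩ f b ⊆ f i → Adj H v i
    back {i} i∈W ab⊆fi with i ≟ a | i ≟ b
    ... | yes refl | _ = v~a
    ... | _ | yes refl = v~b
    -- `f i` contains the `k` common vertices of `f a` and `f b`, so `i` is adjacent to both `a` and
    -- `b`.
    ... | no i≢a | no i≢b = diamond-free H block conn v∉W a∈W b∈W i∈W a≢b v~a v~b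
      (share⇒adj i∈W a∈W i≢a (k≤ (p∩q⊆p (f a) (f b))))
      (share⇒adj i∈W b∈W i≢b (k≤ (p∩q⊆q (f a) (f b))))
      where
      k≤ : ∀ {c} → f a ∩ f b ⊆ f c → k ≤ ∣ f i ∩ f c ∣
      k≤ ab⊆fc = ≤-trans (adj⇒share a∈W b∈W a≢b a~b)
        (p⊆q⇒∣p∣≤∣q∣ λ x∈ → x∈p∩q⁺ (ab⊆fi x∈ , ab⊆fc x∈))
  -- `a` is the only neighbour of `v` in `W`, so the facet must lie in `f a` and in no other clique
  -- `f i` with `i ∈ W`.
  ... | no only-a with free-facet m≤k a∈W
  ...   | s , s∈ , free =
    f a - s , ℕ.suc-injective (trans (x∈p⇒1+∣p-x∣≡∣p∣ s∈) (f-size a∈W)) ,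
    (a , a∈W , p─q⊆p (f a) ⁅ s ⁆) , λ i∈W → forth i∈W , back i∈W
    where
    forth : ∀ {i} → i ∈ W → Adj H v i → f a - s ⊆ f i
    forth {i} i∈W v~i with i ≟ a
    ... | yes refl = p─q⊆p (f a) ⁅ s ⁆
    ... | no  i≢a  = contradiction (i , i∈W , i≢a , v~i) only-a
    back : ∀ {i} → i ∈ W → f a - s ⊆ f i → Adj H v i
    back {i} i∈W facet⊆ with i ≟ a
    ... | yes refl = v~a
    ... | no  i≢a  = ⊥-elim (free i∈W i≢a facet⊆)

connected-∪ : (H : Graph m) {W : Subset m} {v a : Fin m} → InducedConnected H W →
              a ∈ W → Adj H v a → InducedConnected H (W ∪ ⁅ v ⁆)
connected-∪ H {W} {v} {a} conn a∈W v~a = hub⇒connected H a to-a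
  where
  W⊆ : W ⊆ W ∪ ⁅ v ⁆
  W⊆ = p⊆p∪q ⁅ v ⁆
  to-a : ∀ {y} → y ∈ W ∪ ⁅ v ⁆ → Reach H (W ∪ ⁅ v ⁆) y a
  to-a y∈ with x∈p∪⁅y⁆⁻ W v y∈
  ... | inj₁ y∈W  = reach-mono H W⊆ (conn _ a y∈W a∈W)
  ... | inj₂ refl = step (here y∈) v~a (W⊆ a∈W)

realisation : (H : Graph m) → InducedConnected H ⊤ → IsBlockGraph H → m ≤ k → Fin m →
              Realisation H k ⊤
realisation {m} {k} H H-conn block m≤k r =
  grow m (m≤m+n m _) (x∈⁅x⁆ r) (hub⇒connected H r to-r) (singleton-realisation H k r)
  where
  to-r : ∀ {y} → y ∈ ⁅ r ⁆ → Reach H ⁅ r ⁆ y r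
  to-r y∈ with x∈⁅y⁆⇒x≡y r y∈
  ... | refl = here y∈
  grow : ∀ d {W} → m ≤ d + ∣ W ∣ → r ∈ W → InducedConnected H W →
         Realisation H k W → Realisation H k ⊤
  grow zero {W} m≤W _ _ R =
    subst (Realisation H k) (∣p∣≡n⇒p≡⊤ (≤-antisym (∣p∣≤n W) m≤W)) R
  grow (suc d) {W} m≤ r∈W conn R with any? (λ v → ¬? (v ∈? W))
  ... | no full = subst (Realisation H k) (⊆-antisym ⊆⊤
          λ {x} _ → decidable-stable (x ∈? W) λ x∉W → full (x , x∉W)) R
  -- `x` need not have a neighbour in `W`; the walk from `r` to `x` yields a vertex `v` outside `W`
  -- that has one.
  ... | yes (x , x∉W) with reach-exits H r∈W x∉W (H-conn r x ∈⊤ ∈⊤)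
  ...   | a , v , a∈W , v∉W , a~v = grow d m≤′ (p⊆p∪q ⁅ v ⁆ r∈W)
          (connected-∪ H conn a∈W (adj-sym H a~v))
          (attach R v∉W (proj₂ (attachmentSet R block conn m≤k v∉W a∈W (adj-sym H a~v))))
    where
    m≤′ : m ≤ d + ∣ W ∪ ⁅ v ⁆ ∣
    m≤′ = ≤-trans m≤ (subst (_≤ d + ∣ W ∪ ⁅ v ⁆ ∣) (+-suc d ∣ W ∣)
            (+-monoʳ-≤ d (x∉p⇒∣p∣<∣p∪⁅x⁆∣ v∉W)))

-- The reduced clique graph of the grown k-tree

realisation⇒iso : (H : Graph m) → 1 ≤ k → (R : Realisation H k ⊤) →
                  IsoToReducedCliqueGraph H (Realisation.graph R)
realisation⇒iso {k = k} H 1≤k R =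
  f , f-maximal , (λ i j → f-injective ∈⊤ ∈⊤) , surjective , λ i j → forth i j , back i j
  where
  open Realisation R
  f-maximal : ∀ i → IsMaximalClique graph (f i)
  f-maximal i = f-clique ∈⊤ , λ Q Q-cl fi⊆Q → ≡-sym (p⊆q∧∣q∣≤∣p∣⇒p≡q fi⊆Q
    (≤-trans (clique-size Q Q-cl) (≤-reflexive (≡-sym (f-size ∈⊤)))))
  surjective : ∀ Q → IsMaximalClique graph Q → ∃ λ i → f i ≡ Q
  surjective Q (Q-cl , Q-max) with f-covers Q Q-cl
  ... | i , _ , Q⊆fi = i , Q-max (f i) (f-clique ∈⊤) Q⊆fi
  forth : ∀ i j → Adj H i j → CrAdj graph (f i) (f j)
  forth i j i~j = k≤∣Q∩Q′∣⇒CrAdj ktree (f-size ∈⊤) (f-size ∈⊤)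
    (i≢j ∘ f-injective ∈⊤ ∈⊤) 1≤k (f-clique ∈⊤) (f-clique ∈⊤) (adj⇒share ∈⊤ ∈⊤ i≢j i~j)
    where
    i≢j : i ≢ j
    i≢j = adj⇒≢ H i~j
  back : ∀ i j → CrAdj graph (f i) (f j) → Adj H i j
  back i j fi~fj@(fi≢fj , _) = share⇒adj ∈⊤ ∈⊤ (fi≢fj ∘ cong f)
    (CrAdj⇒k≤∣Q∩Q′∣ ktree (f-size ∈⊤) (f-size ∈⊤) fi≢fj fi~fj)

theorem12 : ∀ {m} (H : Graph m) → Connected H → IsBlockGraph H →
    Σ ℕ λ k → (1 ≤ k) × Σ ℕ λ n → Σ (Graph n) λ G →
    KTree k G × IsoToReducedCliqueGraph H G
theorem12 {suc m} H (1≤m , H-conn) block =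
  -- `k` is the number of vertices of `H`, the least value that `realisation` admits, so `1≤m` also
  -- serves as `1 ≤ k`.
  suc m , 1≤m , _ , graph , ktree , realisation⇒iso H 1≤m R
  where
  R : Realisation H (suc m) ⊤
  R = realisation H H-conn block ≤-refl zero
  open Realisation R
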